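{- Let $n=p^\alpha$ be a power of a prime $p$, let $q=p^\omega$ with $\omega\mid\alpha$, let $H=\mathrm{Gal}(GF(n)/GF(q))$, and let $X$ be the AST obtained from the action of $ASL_H(2,n)$. The following equations hold for any $a,b\in GF(n)\setminus\{0,1\}$ and any $\mathfrak a,\mathfrak b\in GF(n)\setminus\{0\}$. 1. $I_1\,A^a\,A^b=p^1I_1$, where $$p^1=\left|\left\{\psi(b):\psi\in H\text{ and }(\exists\tau\in H)[\tau(a)\psi(b)=1]\right\}\right|.$$ 2. $A^a\,I_2\,A^b=p^2I_2$, where $$p^2=\left|\left\{\psi(b):\psi\in H\text{ and }(\exists\tau\in H)[\tau(a)\psi(b)=\tau(a)+\psi(b)]\right\}\right|.$$ 3. $A^a\,A^b\,I_3=p^3I_3$, where $$p^3=\left|\left\{\psi(b):\psi\in H\text{ and }(\exists\tau\in H)[\tau(a)+\psi(b)=1]\right\}\right|.$$ 4. $I_1\,A^a\;{}^{\mathfrak a}A=I_1\;{}^{\mathfrak a}A\;A^a=A^a\,I_2\;{}^{\mathfrak a}A={}^{\mathfrak a}A\;I_2\,A^a=A^a\;{}^{\mathfrak a}A\;I_3={}^{\mathfrak a}A\;A^a\,I_3=0$. 5. $I_1\;{}^{\mathfrak a}A\;{}^{\mathfrak b}A=p^*I_1$, $\;{}^{\mathfrak a}A\;I_2\;{}^{\mathfrak b}A=p^*I_2$, and ${}^{\mathfrak a}A\;{}^{\mathfrak b}A\;I_3=p^*I_3$, where $$p^*=q\left|\left\{\psi(\mathfrak b):\psi\in H\text{ and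 }(\exists\tau\in H)[\tau(\mathfrak a)=-\psi(\mathfrak b)]\right\}\right|.$$ (Here the superscripts $1,2,3,*$ on $p$ are labels, not exponents.)
   Context: Association scheme on triples (AST). Let $\Omega$ be a finite set with at least 3 elements. An AST on $\Omega$ is a partition $X=\{R_i\}_{i=0}^m$ of $\Omega\times\Omega\times\Omega$, $m\ge 4$, such that: (1) for each $i$ there is an integer $n_i^{(3)}$ such that for every pair of distinct $x,y\in\Omega$ the number of $z\in\Omega$ with $(x,y,z)\in R_i$ is $n_i^{(3)}$; (2) for all $i,j,k,l$ there is a constant $p_{ijk}^l$ (an intersection number) such that for every $(x,y,z)\in R_l$ the number of $w$ with $(w,y,z)\in R_i$, $(x,w,z)\in R_j$, $(x,y,w)\in R_k$ is $p_{ijk}^l$; (3) for every $i$ and every $\sigma\in S_3$ there is $j$ with $R_j=\{(x_{\sigma(1)},x_{\sigma(2)},x_{\sigma(3)}):(x_1,x_2,x_3)\in R_i\}$; (4) $R_0=\{(x,x,x):x\in\Omega\}$, $R_1=\{(x,y,y):x\ne y\}$, $R_2=\{(y,x,y):x\neq y\}$, $R_3=\{(y,y,x):x\ne y\}$. If a group $G$ acts two-transitively on $\Omega$, the set of orbits of the induced diagonal action of $G$ on $\Omega\times\Omega\times\Omega$ is an AST, called the AST obtained from (the action of) $G$. Adjacency hypermatrices and ternary product. The adjacency hypermatrix of a relation $R\subseteq\Omega^3$ is the $0/1$ array $A$ indexed by $\Omega^3$ with $A_{xyz}=1$ iff $(x,y,z)\in R$. The ternary product of hypermatrices $A,B,C$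 is $(ABC)_{xyz}=\sum_{w\in\Omega}A_{wyz}B_{xwz}C_{xyw}$, so that $A_iA_jA_k=\sum_l p_{ijk}^l A_l$ for the adjacency hypermatrices $A_i$ of the relations $R_i$ of an AST. The group. $GF(n)$ is the field with $n$ elements, $V=GF(n)^2$ is the 2-dimensional vector space on which the group acts, and $H$ acts on $V$ coordinatewise. $ASL_H(2,n)=ASL(2,n)\rtimes H$ is the group of maps $V\to V$, $x\mapsto B\phi(x)+b$ with $B\in SL(2,n)$, $b\in V$, $\phi\in H$. For $a\in GF(n)$, $\vec a=(a,0)^T\in V$, and $[(u,v,w)]$ is the orbit of $(u,v,w)\in V^3$ under $ASL_H(2,n)$. For $a\in GF(n)\setminus\{0,1\}$, $A^a$ is the adjacency hypermatrix of the relation $R^a=[(\vec 0,\vec 1,\vec a)]$. For $\mathfrak a\in GF(n)\setminus\{0\}$, ${}^{\mathfrak a}A$ is the adjacency hypermatrix of the relation ${}^{\mathfrak a}R=[(\vec 0,\vec 1,(0,\mathfrak a)^T)]$. $I_1,I_2,I_3$ are the adjacency hypermatrices of the trivial relations $R_1,R_2,R_3$ of $X$ (on $\Omega=V$).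
   Formalization: In item 5 the factor q in p* is replaced by n, since the printed formula fails (for n=4, q=2, 𝔞=𝔟=1 the entry is 4, not 2); the two agree when q=n or the set is empty. -}

module Defs where

open import Algebra.Bundles using (CommutativeRing)
open import Algebra.Bundles.Raw using (RawRing)
open import Algebra.Morphism.Structures using (IsRingMonomorphism; IsRingIsomorphism)
open import Algebra.Structures using (IsCommutativeRing)
open import Data.Bool.Base using (if_then_else_)
open import Data.Fin.Base using (Fin; zero; suc)
import Data.Fin.Properties as Fin
open import Data.List.Base using (List; allFin; cartesianProduct; filter; length; map)
open import Data.Nat.Base using (ℕ; zero; suc)
import Data.Nat.Base as ℕ
import Data.Nat.ListAction as ℕ using (sum)
open import Data.Product.Base using (Σ; ∃; _×_; _,_; proj₁; proj₂)
open import Data.Product.Properties using (≡-dec)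
import Data.Vec.Functional as Vector
open import Function.Base using (_∘_)
open import Function.Bundles using (_↔_; Inverse)
open import Level using (0ℓ)
open import Relation.Binary.Definitions using (DecidableEquality)
open import Relation.Binary.PropositionalEquality
  using (_≡_; _≢_; _≗_; refl; sym; trans; cong; cong₂; subst)
open import Relation.Nullary.Decidable using (Dec; decidable-stable; does; map′; _×-dec_; ¬?)
open import Relation.Unary using (Pred; Decidable)

------------------------------------------------------------------------
-- Finite fields

record FiniteField (n : ℕ) : Set₁ where
  infixl 7 _*_
  infixl 6 _+_ _-_
  infix  8 -_
  field
    Carrier           : Set
    _+_ _*_           : Carrier → Carrier → Carrier
    -_                : Carrier → Carrier
    0# 1#             : Carrier
    isCommutativeRing : IsCommutativeRing _≡_ _+_ _*_ -_ 0# 1#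
    1≢0               : 1# ≢ 0#
    inverse           : ∀ x → x ≢ 0# → ∃ λ y → x * y ≡ 1#
    enumeration       : Carrier ↔ Fin n

  _-_ : Carrier → Carrier → Carrier
  x - y = x + (- y)

  commutativeRing : CommutativeRing 0ℓ 0ℓ
  commutativeRing = record { isCommutativeRing = isCommutativeRing }

  rawRing : RawRing 0ℓ 0ℓ
  rawRing = CommutativeRing.rawRing commutativeRing

  elements : List Carrier
  elements = map (Inverse.from enumeration) (allFin n)

record FieldEmbedding {q n} (K : FiniteField q) (F : FiniteField n) : Set where
  private
    module K = FiniteField K
    module F = FiniteField F
  field
    ⟦_⟧                : K.Carrier → F.Carrier
    isRingMonomorphism : IsRingMonomorphism K.rawRing F.rawRing ⟦_⟧

------------------------------------------------------------------------
-- Decidability of statements about a finite field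

module FiniteFieldDec {n} (F : FiniteField n) where
  open FiniteField F
  open Inverse enumeration

  from-to : ∀ x → from (to x) ≡ x
  from-to x = inverseʳ refl

  infix 4 _≟_

  _≟_ : DecidableEquality Carrier
  x ≟ y = map′ (λ e → trans (sym (from-to x)) (trans (cong from e) (from-to y)))
               (cong to) (to x Fin.≟ to y)

  any? : {P : Pred Carrier 0ℓ} → Decidable P → Dec (∃ P)
  any? {P} P? = map′ (λ (i , p) → from i , p)
                     (λ (x , p) → to x , subst P (sym (from-to x)) p)
                     (Fin.any? (P? ∘ from))

  all? : {P : Pred Carrier 0ℓ} → Decidable P → Dec (∀ x → P x)
  all? {P} P? = map′ (λ h x → subst P (from-to x) (h (to x)))
                     (λ h i → h (from i))
                     (Fin.all? (P? ∘ from))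

  anyVector? : ∀ m {P : Pred (Vector.Vector Carrier m) 0ℓ} →
               (∀ {f g} → f ≗ g → P f → P g) → Decidable P → Dec (∃ P)
  anyVector? zero resp P? =
    map′ (λ p → Vector.[] , p) (λ (f , p) → resp (λ ()) p) (P? Vector.[])
  anyVector? (suc m) {P} resp P? =
    map′ (λ (x , f , p) → x Vector.∷ f , p)
         (λ (f , p) → f zero , f ∘ suc , resp (split f) p)
         (any? λ x → anyVector? m (λ e → resp (∷-cong x e)) (P? ∘ (x Vector.∷_)))
    where
    split : ∀ f → f ≗ (f zero Vector.∷ (f ∘ suc))
    split f zero    = refl
    split f (suc i) = refl

    ∷-cong : ∀ x {f g : Vector.Vector Carrier m} →
             f ≗ g → (x Vector.∷ f) ≗ (x Vector.∷ g)
    ∷-cong x e zero    = refl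
    ∷-cong x e (suc i) = e i

  anyMap? : {P : Pred (Carrier → Carrier) 0ℓ} →
            (∀ {f g} → f ≗ g → P f → P g) → Decidable P → Dec (∃ P)
  anyMap? resp P? =
    map′ (λ (v , p) → v ∘ to , p)
         (λ (f , p) → f ∘ from , resp (λ x → cong f (sym (from-to x))) p)
         (anyVector? n (λ e → resp (e ∘ to)) (P? ∘ (_∘ to)))

  card : {P : Pred Carrier 0ℓ} → Decidable P → ℕ
  card P? = length (filter P? elements)

------------------------------------------------------------------------
-- The Galois group of F over (the image of) K

module Galois {q n} {K : FiniteField q} {F : FiniteField n}
              (ι : FieldEmbedding K F) where
  open FiniteField F
  open FiniteFieldDec F
  open FieldEmbedding ι
  private module K = FiniteField K

  record Gal : Set where
    field
      fun               : Carrier → Carrier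
      isRingIsomorphism : IsRingIsomorphism rawRing rawRing fun
      fixes             : ∀ k → fun ⟦ k ⟧ ≡ ⟦ k ⟧

  open Gal public using (fun)

  Laws : Pred (Carrier → Carrier) 0ℓ
  Laws f = (∀ x y → f (x + y) ≡ f x + f y)
         × (∀ x y → f (x * y) ≡ f x * f y)
         × (∀ x → f (- x) ≡ - f x)
         × f 0# ≡ 0#
         × f 1# ≡ 1#
         × (∀ y → ∃ λ x → f x ≡ y)
         × (∀ k → f ⟦ k ⟧ ≡ ⟦ k ⟧)

  laws? : Decidable Laws
  laws? f = (all? λ x → all? λ y → f (x + y) ≟ f x + f y)
      ×-dec (all? λ x → all? λ y → f (x * y) ≟ f x * f y)
      ×-dec (all? λ x → f (- x) ≟ - f x)
      ×-dec f 0# ≟ 0#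
      ×-dec f 1# ≟ 1#
      ×-dec (all? λ y → any? λ x → f x ≟ y)
      ×-dec (FiniteFieldDec.all? K λ k → f ⟦ k ⟧ ≟ ⟦ k ⟧)

  laws-resp : ∀ {f g} → f ≗ g → Laws f → Laws g
  laws-resp e (l+ , l* , l- , l0 , l1 , onto , fix) =
      (λ x y → trans (sym (e _)) (trans (l+ x y) (cong₂ _+_ (e x) (e y))))
    , (λ x y → trans (sym (e _)) (trans (l* x y) (cong₂ _*_ (e x) (e y))))
    , (λ x → trans (sym (e _)) (trans (l- x) (cong -_ (e x))))
    , trans (sym (e _)) l0
    , trans (sym (e _)) l1
    , (λ y → proj₁ (onto y) , trans (sym (e _)) (proj₂ (onto y)))
    , (λ k → trans (sym (e _)) (fix k))

  laws : ∀ φ → Laws (fun φ)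
  laws φ = +-homo , *-homo , -‿homo , 0#-homo , 1#-homo
         , (λ y → proj₁ (surjective y) , proj₂ (surjective y) refl)
         , Gal.fixes φ
    where open IsRingIsomorphism (Gal.isRingIsomorphism φ)

  module FromLaws (f : Carrier → Carrier) (l : Laws f) where
    open CommutativeRing commutativeRing
      using (+-assoc; +-identityʳ; +-identityˡ; -‿inverseˡ; -‿inverseʳ; zeroˡ)
    private
      l+ = proj₁ l
      l* = proj₁ (proj₂ l)
      l- = proj₁ (proj₂ (proj₂ l))
      l0 = proj₁ (proj₂ (proj₂ (proj₂ l)))
      l1 = proj₁ (proj₂ (proj₂ (proj₂ (proj₂ l))))
      on = proj₁ (proj₂ (proj₂ (proj₂ (proj₂ (proj₂ l)))))
      fx = proj₂ (proj₂ (proj₂ (proj₂ (proj₂ (proj₂ l)))))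

    kernel : ∀ x → f x ≡ 0# → x ≡ 0#
    kernel x fx≡0 = decidable-stable (x ≟ 0#) λ x≢0 →
      let y , xy≡1 = inverse x x≢0 in
      1≢0 (trans (sym l1) (trans (cong f (sym xy≡1))
            (trans (l* x y) (trans (cong (_* f y) fx≡0) (zeroˡ (f y))))))

    injective : ∀ {x y} → f x ≡ f y → x ≡ y
    injective {x} {y} e = trans (sym (+-identityʳ x))
      (trans (cong (x +_) (sym (-‿inverseˡ y)))
      (trans (sym (+-assoc x (- y) y))
      (trans (cong (_+ y) (kernel (x - y) x-y)) (+-identityˡ y))))
      where
      x-y : f (x - y) ≡ 0#
      x-y = trans (l+ x (- y)) (trans (cong₂ _+_ e (l- y)) (-‿inverseʳ (f y)))

    gal : Gal
    gal = record
      { fun = f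
      ; isRingIsomorphism = record
        { isRingMonomorphism = record
          { isRingHomomorphism = record
            { isSemiringHomomorphism = record
              { isNearSemiringHomomorphism = record
                { +-isMonoidHomomorphism = record
                  { isMagmaHomomorphism = record
                    { isRelHomomorphism = record { cong = cong f }
                    ; homo = l+ }
                  ; ε-homo = l0 }
                ; *-homo = l* }
              ; 1#-homo = l1 }
            ; -‿homo = l- }
          ; injective = injective }
        ; surjective = λ y → proj₁ (on y) , λ { refl → proj₂ (on y) } }
      ; fixes = fx }

  anyGal? : {P : Pred (Carrier → Carrier) 0ℓ} →
            (∀ {f g} → f ≗ g → P f → P g) → Decidable P →
            Dec (Σ Gal λ φ → P (fun φ))
  anyGal? resp P? =
    map′ (λ (f , l , p) → FromLaws.gal f l , p)
         (λ (φ , p) → fun φ , laws φ , p)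
         (anyMap? (λ e (l , p) → laws-resp e l , resp e p)
                  (λ f → laws? f ×-dec P? f))

  -- The set { ψ(b) : ψ ∈ H and (∃ τ ∈ H) [ τ(a) ~ ψ(b) ] }.
  ImagesRelated : (_~_ : Carrier → Carrier → Set) → Carrier → Carrier → Pred Carrier 0ℓ
  ImagesRelated _~_ a b c =
    Σ Gal λ ψ → fun ψ b ≡ c × Σ Gal λ τ → fun τ a ~ fun ψ b

  imagesRelated? : {_~_ : Carrier → Carrier → Set} → (∀ s t → Dec (s ~ t)) →
                   ∀ a b → Decidable (ImagesRelated _~_ a b)
  imagesRelated? {_~_} _~?_ a b c =
    anyGal? {P = λ f → f b ≡ c × Σ Gal λ τ → fun τ a ~ f b}
      (λ e (p , τ , r) → trans (sym (e b)) p , τ , subst (fun τ a ~_) (e b) r)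
      (λ f → f b ≟ c ×-dec
             anyGal? {P = λ g → g a ~ f b} (λ e → subst (_~ f b) (e a)) (λ g → g a ~? f b))

  p¹ p² p³ p* : Carrier → Carrier → ℕ
  p¹ a b = card (imagesRelated? (λ s t → s * t ≟ 1#) a b)
  p² a b = card (imagesRelated? (λ s t → s * t ≟ s + t) a b)
  p³ a b = card (imagesRelated? (λ s t → s + t ≟ 1#) a b)
  -- The factor is n = |F|, not q = |K|: a point z with (0⃗ , 1⃗ , z) in the orbit
  -- of (0⃗ , 1⃗ , (0 , b)) has second coordinate in the H-orbit of b, but its first
  -- coordinate ranges over all of F, by the shears (x , y) ↦ (x + c y , y).
  p* a b = n ℕ.* card (imagesRelated? (λ s t → s ≟ - t) a b)

------------------------------------------------------------------------
-- ASL_H(2,n) acting on V, and the hypermatrices of its orbits on V³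

module ASL {q n} {K : FiniteField q} {F : FiniteField n}
           (ι : FieldEmbedding K F) where
  open FiniteField F
  open FiniteFieldDec F
  open Galois ι public

  V : Set
  V = Carrier × Carrier

  _≟ᵛ_ : DecidableEquality V
  _≟ᵛ_ = ≡-dec _≟_ _≟_

  points : List V
  points = cartesianProduct elements elements

  record Matrix : Set where
    constructor mat
    field
      b₁₁ b₁₂ b₂₁ b₂₂ : Carrier

  det : Matrix → Carrier
  det (mat b₁₁ b₁₂ b₂₁ b₂₂) = b₁₁ * b₂₂ - b₁₂ * b₂₁

  record ASL_H : Set where
    constructor asl
    field
      B     : Matrix
      det≡1 : det B ≡ 1#
      φ     : Gal
      b     : V

  affine : Matrix → (Carrier → Carrier) → V → V → V
  affine (mat b₁₁ b₁₂ b₂₁ b₂₂) f (t₁ , t₂) (x₁ , x₂) =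
    (b₁₁ * f x₁ + b₁₂ * f x₂) + t₁ , (b₂₁ * f x₁ + b₂₂ * f x₂) + t₂

  infixr 8 _▸_

  _▸_ : ASL_H → V → V
  asl B _ φ b ▸ x = affine B (fun φ) b x

  V³ : Set
  V³ = V × V × V

  Orbit : V³ → Pred V³ 0ℓ
  Orbit (u , v , w) t = Σ ASL_H λ g → (g ▸ u , g ▸ v , g ▸ w) ≡ t

  private
    _≟³_ : DecidableEquality V³
    _≟³_ = ≡-dec _≟ᵛ_ (≡-dec _≟ᵛ_ _≟ᵛ_)

    anyV? : {P : Pred V 0ℓ} → Decidable P → Dec (∃ P)
    anyV? P? = map′ (λ (x , y , p) → (x , y) , p) (λ ((x , y) , p) → x , y , p)
                    (any? λ x → any? λ y → P? (x , y))

    anyMatrix? : {P : Pred Matrix 0ℓ} → Decidable P → Dec (∃ P)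
    anyMatrix? P? =
      map′ (λ (x , y , z , w , p) → mat x y z w , p)
           (λ (mat x y z w , p) → x , y , z , w , p)
           (any? λ x → any? λ y → any? λ z → any? λ w → P? (mat x y z w))

    affine-cong : ∀ B {f g} → f ≗ g → ∀ b x → affine B f b x ≡ affine B g b x
    affine-cong (mat _ _ _ _) e _ (x₁ , x₂) rewrite e x₁ | e x₂ = refl

  orbit? : ∀ t → Decidable (Orbit t)
  orbit? (u , v , w) t =
    map′ (λ (B , d , b , φ , e) → asl B d φ b , e)
         (λ (asl B d φ b , e) → B , d , b , φ , e)
      (anyMatrix? λ B → det B ≟ 1# ×-dec anyV? λ b →
        anyGal? {P = λ f → (affine B f b u , affine B f b v , affine B f b w) ≡ t}
          (λ e → trans (sym (cong₂ _,_ (affine-cong B e b u)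
                       (cong₂ _,_ (affine-cong B e b v) (affine-cong B e b w)))))
          (λ f → _ ≟³ t))

  Hypermatrix : Set
  Hypermatrix = V → V → V → ℕ

  adjacency : {R : Pred V³ 0ℓ} → Decidable R → Hypermatrix
  adjacency R? x y z = if does (R? (x , y , z)) then 1 else 0

  infix  4 _≐_
  infixr 7 _•_

  _≐_ : Hypermatrix → Hypermatrix → Set
  A ≐ B = ∀ x y z → A x y z ≡ B x y z

  𝟘 : Hypermatrix
  𝟘 x y z = 0

  _•_ : ℕ → Hypermatrix → Hypermatrix
  (k • A) x y z = k ℕ.* A x y z

  ⟨_,_,_⟩ : Hypermatrix → Hypermatrix → Hypermatrix → Hypermatrix
  ⟨ A , B , C ⟩ x y z = ℕ.sum (map (λ w → A w y z ℕ.* B x w z ℕ.* C x y w) points)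

  R₁ R₂ R₃ : Pred V³ 0ℓ
  R₁ (x , y , z) = x ≢ y × y ≡ z
  R₂ (x , y , z) = x ≢ y × x ≡ z
  R₃ (x , y , z) = x ≢ z × x ≡ y

  I₁ I₂ I₃ : Hypermatrix
  I₁ = adjacency {R₁} λ (x , y , z) → ¬? (x ≟ᵛ y) ×-dec y ≟ᵛ z
  I₂ = adjacency {R₂} λ (x , y , z) → ¬? (x ≟ᵛ y) ×-dec x ≟ᵛ z
  I₃ = adjacency {R₃} λ (x , y , z) → ¬? (x ≟ᵛ z) ×-dec x ≟ᵛ y

  infix 9 _⃗

  _⃗ : Carrier → V
  a ⃗ = a , 0#

  -- A^ a and ᴬ a are the hypermatrices written Aᵃ and ᵃA.
  A^ ^A : Carrier → Hypermatrix
  A^ a = adjacency (orbit? (0# ⃗ , 1# ⃗ , a ⃗))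
  ^A a = adjacency (orbit? (0# ⃗ , 1# ⃗ , (0# , a)))

{-# OPTIONS --safe #-}
-- The orbit of (0⃗ , 1⃗ , a⃗) consists of the triples (x , y , z) with x ≠ y and
-- z = x + τ(a) (y - x) for some τ ∈ H, and the orbit of (0⃗ , 1⃗ , (0 , a)) of those
-- whose oriented area det (y - x , z - x) is τ(a) for some τ ∈ H: in both cases the
-- required matrix of determinant 1 can be written down from y - x and a complement.
-- The area changes sign under transpositions of the points, so the two kinds of orbits
-- never meet after permuting coordinates, which gives the zero products.  In the other
-- products the points w that contribute to an entry lie on the line through two fixed
-- points and have parameter ψ(b) (or its inverse), or else they have prescribed area
-- ψ(b) up to sign with respect to these points and one free coordinate in F.
module Submission where

open import Defs
open import Data.Nat.Base using (ℕ; _^_; suc; zero)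
open import Data.Nat.Divisibility using (_∣_)
open import Data.Nat.Primality using (Prime)
open import Data.Product.Base using (_×_)
open import Relation.Binary.PropositionalEquality using (_≢_)

open import Algebra.Bundles using (CommutativeRing)
import Algebra.Properties.AbelianGroup as AbelianGroupProperties
import Algebra.Properties.Ring as RingProperties
import Algebra.Properties.Semiring.Mult.TCOptimised as Multiples
import Algebra.Solver.Ring as RingSolver
open import Algebra.Solver.Ring.AlmostCommutativeRing
  using (fromCommutativeRing; _-Raw-AlmostCommutative⟶_)
open import Data.Bool.Base using (true; false; if_then_else_)
open import Data.Integer.Base using (ℤ; 0ℤ; 1ℤ)
import Data.Integer.Base as ℤ
import Data.Integer.Properties as ℤ
open import Data.List.Base
  using (List; []; _∷_; allFin; cartesianProduct; filter; length; map)
open import Data.List.Membership.Propositional using (_∈_)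
import Data.List.Membership.Propositional.Properties as ∈
open import Data.List.Membership.Propositional.Properties.WithK using (unique∧set⇒bag)
import Data.List.Properties as List
open import Data.List.Relation.Binary.BagAndSetEquality using (∼bag⇒↭)
open import Data.List.Relation.Binary.Permutation.Propositional.Properties using (↭-length)
import Data.List.Relation.Unary.All as All
open import Data.List.Relation.Unary.Unique.Propositional using (Unique)
import Data.List.Relation.Unary.Unique.Propositional.Properties as Unique
import Data.Maybe.Base as Maybe
import Data.Nat.Base as ℕ
import Data.Nat.ListAction as ℕ using (sum)
import Data.Nat.Properties as ℕ
open import Data.Product.Base using (Σ; ∃; _,_; proj₁; proj₂)
open import Data.Sum.Base using ([_,_]′)
open import Function.Base using (_∘_; _$_)
open import Function.Bundles using (Inverse; mk⇔)
open import Level using (0ℓ)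
import Relation.Binary.PropositionalEquality as ≡
open import Relation.Nullary using (¬_; Dec; yes; no; contradiction)
open import Relation.Nullary.Decidable using (does; dec⇒maybe; _×-dec_; toSum; ¬?)
open import Relation.Unary using (Pred; Decidable)

-- Polynomial identities over a commutative ring, with integer coefficients

module IntegerCoefficients {c ℓ} (R : CommutativeRing c ℓ) where
  open CommutativeRing R
  open import Data.Integer.Base using (+_; -[1+_]; _⊖_)
  open Multiples semiring renaming (_×_ to _×ᴿ_)
  open RingProperties ring using (-‿distribˡ-*; -‿distribʳ-*; -‿involutive; -0#≈0#)
  open AbelianGroupProperties +-abelianGroup using (⁻¹-∙-comm)
  open import Relation.Binary.Reasoning.Setoid setoid

  -- The canonical homomorphism from the integers. With the optimised multiples `⟦ 1ℤ ⟧` reduces to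
  -- `1#` itself, so `con 1ℤ` in a solver expression stands for `1#` definitionally.
  ⟦_⟧ : ℤ → Carrier
  ⟦ + n ⟧      = n ×ᴿ 1#
  ⟦ -[1+ n ] ⟧ = - (suc n ×ᴿ 1#)

  ⟦-⟧-homo : ∀ i → ⟦ ℤ.- i ⟧ ≈ - ⟦ i ⟧
  ⟦-⟧-homo (+ zero)   = sym -0#≈0#
  ⟦-⟧-homo (+ suc n)  = refl
  ⟦-⟧-homo -[1+ n ]   = sym (-‿involutive _)

  -- Removing a successor on both sides of `⊖` corresponds to cancelling `1# - 1#` in the ring.
  ⊖-homo : ∀ m n → ⟦ m ⊖ n ⟧ ≈ m ×ᴿ 1# - n ×ᴿ 1#
  ⊖-homo m       zero    = sym (trans (+-congˡ -0#≈0#) (+-identityʳ _))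
  ⊖-homo zero    (suc n) = sym (+-identityˡ _)
  ⊖-homo (suc m) (suc n) = begin
    ⟦ suc m ⊖ suc n ⟧                            ≡⟨ ≡.cong ⟦_⟧ (ℤ.[1+m]⊖[1+n]≡m⊖n m n) ⟩
    ⟦ m ⊖ n ⟧                                    ≈⟨ ⊖-homo m n ⟩
    m ×ᴿ 1# - n ×ᴿ 1#                            ≈⟨ +-congʳ (+-identityʳ _) ⟨
    (m ×ᴿ 1# + 0#) - n ×ᴿ 1#                     ≈⟨ +-congʳ (+-congˡ (-‿inverseʳ 1#)) ⟨
    (m ×ᴿ 1# + (1# - 1#)) - n ×ᴿ 1#              ≈⟨ +-congʳ (+-assoc _ _ _) ⟨
    ((m ×ᴿ 1# + 1#) - 1#) - n ×ᴿ 1#              ≈⟨ +-assoc _ _ _ ⟩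
    (m ×ᴿ 1# + 1#) + (- 1# - n ×ᴿ 1#)            ≈⟨ +-cong (+-comm _ _) (⁻¹-∙-comm _ _) ⟩
    (1# + m ×ᴿ 1#) - (1# + n ×ᴿ 1#)              ≈⟨ +-cong (1+× m 1#) (-‿cong (1+× n 1#)) ⟨
    suc m ×ᴿ 1# - suc n ×ᴿ 1#                    ∎

  ⟦+⟧-homo : ∀ i j → ⟦ i ℤ.+ j ⟧ ≈ ⟦ i ⟧ + ⟦ j ⟧
  ⟦+⟧-homo (+ m)    (+ n)    = ×-homo-+ 1# m n
  ⟦+⟧-homo (+ m)    -[1+ n ] = ⊖-homo m (suc n)
  ⟦+⟧-homo -[1+ m ] (+ n)    = trans (⊖-homo n (suc m)) (+-comm _ _)
  ⟦+⟧-homo -[1+ m ] -[1+ n ] = begin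
    - (suc (suc (m ℕ.+ n)) ×ᴿ 1#)         ≡⟨ ≡.cong (λ k → - (suc k ×ᴿ 1#)) (ℕ.+-suc m n) ⟨
    - ((suc m ℕ.+ suc n) ×ᴿ 1#)           ≈⟨ -‿cong (×-homo-+ 1# (suc m) (suc n)) ⟩
    - (suc m ×ᴿ 1# + suc n ×ᴿ 1#)         ≈⟨ ⁻¹-∙-comm _ _ ⟨
    - (suc m ×ᴿ 1#) - suc n ×ᴿ 1#         ∎

  -- Shared by the two mixed-sign cases of `⟦*⟧-homo`, which differ only in the factor that absorbs
  -- the sign.
  neg-*-homo : ∀ m n {x} → - ((m ×ᴿ 1#) * (n ×ᴿ 1#)) ≈ x → ⟦ ℤ.- (+ (m ℕ.* n)) ⟧ ≈ x
  neg-*-homo m n e = trans (⟦-⟧-homo (+ (m ℕ.* n))) (trans (-‿cong (×1-homo-* m n)) e)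

  ⟦*⟧-homo : ∀ i j → ⟦ i ℤ.* j ⟧ ≈ ⟦ i ⟧ * ⟦ j ⟧
  ⟦*⟧-homo (+ m) (+ n) rewrite ℤ.+◃n≡+n (m ℕ.* n) = ×1-homo-* m n
  ⟦*⟧-homo (+ m) -[1+ n ] rewrite ℤ.-◃n≡-n (m ℕ.* suc n) =
    neg-*-homo m (suc n) (-‿distribʳ-* _ _)
  ⟦*⟧-homo -[1+ m ] (+ n) rewrite ℤ.-◃n≡-n (suc m ℕ.* n) =
    neg-*-homo (suc m) n (-‿distribˡ-* _ _)
  ⟦*⟧-homo -[1+ m ] -[1+ n ] = begin
    (suc m ℕ.* suc n) ×ᴿ 1#                ≈⟨ ×1-homo-* (suc m) (suc n) ⟩
    (suc m ×ᴿ 1#) * (suc n ×ᴿ 1#)          ≈⟨ -‿involutive _ ⟨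
    - - ((suc m ×ᴿ 1#) * (suc n ×ᴿ 1#))    ≈⟨ -‿cong (-‿distribˡ-* _ _) ⟩
    - (- (suc m ×ᴿ 1#) * (suc n ×ᴿ 1#))    ≈⟨ -‿distribʳ-* _ _ ⟩
    - (suc m ×ᴿ 1#) * - (suc n ×ᴿ 1#)      ∎

  morphism : ℤ.+-*-rawRing -Raw-AlmostCommutative⟶ fromCommutativeRing R
  morphism = record
    { ⟦_⟧    = ⟦_⟧
    ; +-homo = ⟦+⟧-homo
    ; *-homo = ⟦*⟧-homo
    ; -‿homo = ⟦-⟧-homo
    ; 0-homo = refl
    ; 1-homo = refl
    }

  -- Coefficients of normal forms are compared in ℤ, where equality is decided by computation even
  -- when `R` has no decidable equality.
  open RingSolver ℤ.+-*-rawRing (fromCommutativeRing R) morphism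
    (λ i j → Maybe.map (λ e → reflexive (≡.cong ⟦_⟧ e)) (dec⇒maybe (i ℤ.≟ j)))
    public using (solve; con; _:+_; _:*_; _:-_; :-_; _:=_)

open ≡ using (_≡_; refl; sym; trans; cong; cong₂; subst; module ≡-Reasoning)

-- Counting with duplicate-free lists and indicator sums

module _ {A B : Set} where

  -- Duplicate-free lists with the same members are permutations of each other; this is applied to
  -- `bs` and `map f as`.
  injection⇒length :
    {as : List A} {bs : List B} → Unique as → Unique bs →
    (f : A → B) → (∀ {a a′} → f a ≡ f a′ → a ≡ a′) →
    (∀ {a} → a ∈ as → f a ∈ bs) →
    (∀ {b} → b ∈ bs → ∃ λ a → a ∈ as × b ≡ f a) →
    length bs ≡ length as
  injection⇒length {as} {bs} as! bs! f inj into onto =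
    trans (↭-length (∼bag⇒↭ (unique∧set⇒bag bs! (Unique.map⁺ inj as!) (mk⇔ to from))))
          (List.length-map f as)
    where
    to : ∀ {b} → b ∈ bs → b ∈ map f as
    to b∈bs with a , a∈as , refl ← onto b∈bs = ∈.∈-map⁺ f a∈as
    from : ∀ {b} → b ∈ map f as → b ∈ bs
    from b∈ with a , a∈as , refl ← ∈.∈-map⁻ f b∈ = into a∈as

length-cartesianProduct : ∀ {A B : Set} (as : List A) (bs : List B) →
  length (cartesianProduct as bs) ≡ length as ℕ.* length bs
length-cartesianProduct []       bs = refl
length-cartesianProduct (a ∷ as) bs =
  trans (List.length-++ (map (a ,_) bs))
        (cong₂ ℕ._+_ (List.length-map (a ,_) bs) (length-cartesianProduct as bs))

indicator : {P : Set} → Dec P → ℕ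
indicator P? = if does P? then 1 else 0

-- A product of three 0/1 values is 1 exactly when all three decisions are positive. It turns an
-- entry of a ternary product into the number of contributing points.
sum-of-indicators : {A : Set} {P Q R : Pred A 0ℓ}
  (P? : Decidable P) (Q? : Decidable Q) (R? : Decidable R) (as : List A) →
  ℕ.sum (map (λ a → indicator (P? a) ℕ.* indicator (Q? a) ℕ.* indicator (R? a)) as)
    ≡ length (filter (λ a → P? a ×-dec Q? a ×-dec R? a) as)
sum-of-indicators P? Q? R? [] = refl
sum-of-indicators P? Q? R? (a ∷ as) with does (P? a) | does (Q? a) | does (R? a)
... | false | _     | _     = sum-of-indicators P? Q? R? as
... | true  | false | _     = sum-of-indicators P? Q? R? as
... | true  | true  | false = sum-of-indicators P? Q? R? as
... | true  | true  | true  = cong suc (sum-of-indicators P? Q? R? as)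

module Geometry {q n} {K : FiniteField q} {F : FiniteField n} (ι : FieldEmbedding K F) where
  open FiniteField F
  open FiniteFieldDec F
  open ASL ι
  open CommutativeRing commutativeRing
    using (+-identityʳ; *-identityˡ; *-identityʳ; *-assoc; *-comm; zeroˡ; zeroʳ; +-abelianGroup; ring)
  open AbelianGroupProperties +-abelianGroup
    using () renaming (x∙y⁻¹≈ε⇒x≈y to x-y≡0⇒x≡y; x≈y⇒x∙y⁻¹≈ε to x≡y⇒x-y≡0)
  open RingProperties ring using (-0#≈0#; -‿involutive)
  open IntegerCoefficients commutativeRing
  open ≡-Reasoning

  -- Affine parameters on lines, and oriented area

  infixl 6 _⊞_ _⊟_
  infixr 7 _·_

  _⊞_ _⊟_ : V → V → V
  (x₁ , x₂) ⊞ (y₁ , y₂) = x₁ + y₁ , x₂ + y₂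
  (x₁ , x₂) ⊟ (y₁ , y₂) = x₁ - y₁ , x₂ - y₂

  _·_ : Carrier → V → V
  c · (x₁ , x₂) = c * x₁ , c * x₂

  cross : V → V → Carrier
  cross (x₁ , x₂) (y₁ , y₂) = x₁ * y₂ - y₁ * x₂

  along : V → V → Carrier → V
  along x y c = x ⊞ c · (y ⊟ x)

  area : V → V → V → Carrier
  area x y z = cross (y ⊟ x) (z ⊟ x)

  along-0 : ∀ x y → along x y 0# ≡ x
  along-0 (x₁ , x₂) (y₁ , y₂) = cong₂ _,_ (lemma x₁ y₁) (lemma x₂ y₂)
    where
    lemma : ∀ x y → x + 0# * (y - x) ≡ x
    lemma = solve 2 (λ x y → x :+ con 0ℤ :* (y :- x) := x) refl

  along-1 : ∀ x y → along x y 1# ≡ y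
  along-1 (x₁ , x₂) (y₁ , y₂) = cong₂ _,_ (lemma x₁ y₁) (lemma x₂ y₂)
    where
    lemma : ∀ x y → x + 1# * (y - x) ≡ y
    lemma = solve 2 (λ x y → x :+ con 1ℤ :* (y :- x) := y) refl

  along-self : ∀ x c → along x x c ≡ x
  along-self (x₁ , x₂) c = cong₂ _,_ (lemma x₁ c) (lemma x₂ c)
    where
    lemma : ∀ x c → x + c * (x - x) ≡ x
    lemma = solve 2 (λ x c → x :+ c :* (x :- x) := x) refl

  -- Parameters with a common origin multiply: the source of the condition `s * t ≡ 1#` in `p¹`.
  along-along : ∀ x y c k → along x (along x y c) k ≡ along x y (k * c)
  along-along (x₁ , x₂) (y₁ , y₂) c k = cong₂ _,_ (lemma x₁ y₁ c k) (lemma x₂ y₂ c k)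
    where
    lemma : ∀ x y c k → x + k * ((x + c * (y - x)) - x) ≡ x + (k * c) * (y - x)
    lemma = solve 4 (λ x y c k →
      x :+ k :* ((x :+ c :* (y :- x)) :- x) := x :+ (k :* c) :* (y :- x)) refl

  -- Distances to the common endpoint `y` multiply, and `1 - (1 - k)(1 - c)` is the new parameter.
  -- In the expanded form it vanishes exactly when `k * c ≡ k + c`, the condition in `p²`.
  along-from-along : ∀ x y c k → along (along x y c) y k ≡ along x y ((k + c) - k * c)
  along-from-along (x₁ , x₂) (y₁ , y₂) c k = cong₂ _,_ (lemma x₁ y₁ c k) (lemma x₂ y₂ c k)
    where
    lemma : ∀ x y c k →
      (x + c * (y - x)) + k * (y - (x + c * (y - x))) ≡ x + ((k + c) - k * c) * (y - x)
    lemma = solve 4 (λ x y c k →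
      (x :+ c :* (y :- x)) :+ k :* (y :- (x :+ c :* (y :- x)))
        := x :+ ((k :+ c) :- k :* c) :* (y :- x)) refl

  -- Exchanging the endpoints complements the parameter: the source of the condition `s + t ≡ 1#` in
  -- `p³`.
  along-reverse : ∀ x y k → along y x k ≡ along x y (1# - k)
  along-reverse (x₁ , x₂) (y₁ , y₂) k = cong₂ _,_ (lemma x₁ y₁ k) (lemma x₂ y₂ k)
    where
    lemma : ∀ x y k → y + k * (x - y) ≡ x + (1# - k) * (y - x)
    lemma = solve 3 (λ x y k →
      y :+ k :* (x :- y) := x :+ (con 1ℤ :- k) :* (y :- x)) refl

  area-degenerate : ∀ x z → area x x z ≡ 0#
  area-degenerate (x₁ , x₂) (z₁ , z₂) =
    solve 4 (λ x₁ x₂ z₁ z₂ →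
      (x₁ :- x₁) :* (z₂ :- x₂) :- (z₁ :- x₁) :* (x₂ :- x₂) := con 0ℤ) refl x₁ x₂ z₁ z₂

  area-along : ∀ x y c → area x y (along x y c) ≡ 0#
  area-along (x₁ , x₂) (y₁ , y₂) c =
    solve 5 (λ x₁ x₂ y₁ y₂ c →
      (y₁ :- x₁) :* ((x₂ :+ c :* (y₂ :- x₂)) :- x₂)
        :- ((x₁ :+ c :* (y₁ :- x₁)) :- x₁) :* (y₂ :- x₂) := con 0ℤ) refl x₁ x₂ y₁ y₂ c

  area-swap₁₂ : ∀ x y z → area y x z ≡ - area x y z
  area-swap₁₂ (x₁ , x₂) (y₁ , y₂) (z₁ , z₂) =
    solve 6 (λ x₁ x₂ y₁ y₂ z₁ z₂ →
      (x₁ :- y₁) :* (z₂ :- y₂) :- (z₁ :- y₁) :* (x₂ :- y₂)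
        := :- ((y₁ :- x₁) :* (z₂ :- x₂) :- (z₁ :- x₁) :* (y₂ :- x₂)))
      refl x₁ x₂ y₁ y₂ z₁ z₂

  area-swap₂₃ : ∀ x y z → area x z y ≡ - area x y z
  area-swap₂₃ (x₁ , x₂) (y₁ , y₂) (z₁ , z₂) =
    solve 6 (λ x₁ x₂ y₁ y₂ z₁ z₂ →
      (z₁ :- x₁) :* (y₂ :- x₂) :- (y₁ :- x₁) :* (z₂ :- x₂)
        := :- ((y₁ :- x₁) :* (z₂ :- x₂) :- (z₁ :- x₁) :* (y₂ :- x₂)))
      refl x₁ x₂ y₁ y₂ z₁ z₂

  area-rotate : ∀ x y z → area y z x ≡ area x y z
  area-rotate x y z = begin
    area y z x      ≡⟨ area-swap₂₃ y x z ⟩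
    - area y x z    ≡⟨ cong -_ (area-swap₁₂ x y z) ⟩
    - - area x y z  ≡⟨ -‿involutive _ ⟩
    area x y z      ∎

  area-swap₁₃ : ∀ x y z → area z y x ≡ - area x y z
  area-swap₁₃ x y z = trans (area-rotate x z y) (area-swap₂₃ x y z)

  ⊟-nonzero : ∀ {x y} → x ≢ y → y ⊟ x ≢ (0# , 0#)
  ⊟-nonzero x≢y y-x≡0 = x≢y $ sym $
    cong₂ _,_ (x-y≡0⇒x≡y _ _ (cong proj₁ y-x≡0)) (x-y≡0⇒x≡y _ _ (cong proj₂ y-x≡0))

  -- The inverse of a nonzero coordinate of `d`, placed in the opposite coordinate of `e` with the
  -- sign of its term in `cross`, gives determinant 1.
  unimodular-complement : ∀ d → d ≢ (0# , 0#) → ∃ λ e → cross d e ≡ 1#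
  unimodular-complement (d₁ , d₂) d≢0 with d₁ ≟ 0# | d₂ ≟ 0#
  ... | no d₁≢0  | _ with i , d₁i≡1 ← inverse d₁ d₁≢0 = (0# , i) ,
    trans (solve 3 (λ d₁ d₂ i → d₁ :* i :- con 0ℤ :* d₂ := d₁ :* i) refl d₁ d₂ i) d₁i≡1
  ... | yes _    | no d₂≢0 with i , d₂i≡1 ← inverse d₂ d₂≢0 = (- i , 0#) ,
    trans (solve 3 (λ d₁ d₂ i → d₁ :* con 0ℤ :- (:- i) :* d₂ := d₂ :* i) refl d₁ d₂ i) d₂i≡1
  ... | yes refl | yes refl = contradiction refl d≢0

  -- A basis (y - x , e) of determinant 1 gives coordinates of w relative to x:
  -- s = cross (w - x) e and t = area x y w.
  module Frame {x y : V} (x≢y : x ≢ y) where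

    e : V
    e = proj₁ (unimodular-complement (y ⊟ x) (⊟-nonzero x≢y))

    cross-e≡1 : cross (y ⊟ x) e ≡ 1#
    cross-e≡1 = proj₂ (unimodular-complement (y ⊟ x) (⊟-nonzero x≢y))

    point : Carrier × Carrier → V
    point (s , t) = (x ⊞ s · (y ⊟ x)) ⊞ t · e

    area-point : ∀ s t → area x y (point (s , t)) ≡ t
    area-point s t = begin
      area x y (point (s , t))  ≡⟨ lemma (proj₁ x) (proj₂ x) (proj₁ y) (proj₂ y) (proj₁ e) (proj₂ e) s t ⟩
      t * cross (y ⊟ x) e       ≡⟨ cong (t *_) cross-e≡1 ⟩
      t * 1#                    ≡⟨ *-identityʳ t ⟩
      t                         ∎
      where
      lemma : ∀ x₁ x₂ y₁ y₂ e₁ e₂ s t →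
        area (x₁ , x₂) (y₁ , y₂) (((x₁ , x₂) ⊞ s · ((y₁ , y₂) ⊟ (x₁ , x₂))) ⊞ t · (e₁ , e₂))
          ≡ t * cross ((y₁ , y₂) ⊟ (x₁ , x₂)) (e₁ , e₂)
      lemma = solve 8 (λ x₁ x₂ y₁ y₂ e₁ e₂ s t →
        (y₁ :- x₁) :* (((x₂ :+ s :* (y₂ :- x₂)) :+ t :* e₂) :- x₂)
          :- (((x₁ :+ s :* (y₁ :- x₁)) :+ t :* e₁) :- x₁) :* (y₂ :- x₂)
          := t :* ((y₁ :- x₁) :* e₂ :- e₁ :* (y₂ :- x₂))) refl

    cross-point : ∀ s t → cross (point (s , t) ⊟ x) e ≡ s
    cross-point s t = begin
      cross (point (s , t) ⊟ x) e  ≡⟨ lemma (proj₁ x) (proj₂ x) (proj₁ y) (proj₂ y) (proj₁ e) (proj₂ e) s t ⟩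
      s * cross (y ⊟ x) e          ≡⟨ cong (s *_) cross-e≡1 ⟩
      s * 1#                       ≡⟨ *-identityʳ s ⟩
      s                            ∎
      where
      lemma : ∀ x₁ x₂ y₁ y₂ e₁ e₂ s t →
        cross ((((x₁ , x₂) ⊞ s · ((y₁ , y₂) ⊟ (x₁ , x₂))) ⊞ t · (e₁ , e₂)) ⊟ (x₁ , x₂)) (e₁ , e₂)
          ≡ s * cross ((y₁ , y₂) ⊟ (x₁ , x₂)) (e₁ , e₂)
      lemma = solve 8 (λ x₁ x₂ y₁ y₂ e₁ e₂ s t →
        (((x₁ :+ s :* (y₁ :- x₁)) :+ t :* e₁) :- x₁) :* e₂
          :- e₁ :* (((x₂ :+ s :* (y₂ :- x₂)) :+ t :* e₂) :- x₂)
          := s :* ((y₁ :- x₁) :* e₂ :- e₁ :* (y₂ :- x₂))) refl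

    point-injective : ∀ {u v} → point u ≡ point v → u ≡ v
    point-injective {s , t} {s′ , t′} eq = cong₂ _,_
      (trans (sym (cross-point s t)) (trans (cong (λ w → cross (w ⊟ x) e) eq) (cross-point s′ t′)))
      (trans (sym (area-point s t)) (trans (cong (area x y) eq) (area-point s′ t′)))

    -- Cramer's rule: any plane vectors `d`, `e`, `v` satisfy `cross d e · v = cross v e · d + cross
    -- d v · e`. Here `d` is `y ⊟ x`, `v` is `w ⊟ x`, and the coefficient on the left is 1 by
    -- `cross-e≡1`.
    point-surjective : ∀ w → w ≡ point (cross (w ⊟ x) e , area x y w)
    point-surjective w = begin
      w                                           ≡⟨ along-1 x w ⟨
      x ⊞ 1# · (w ⊟ x)                            ≡⟨ cong (λ k → x ⊞ k · (w ⊟ x)) cross-e≡1 ⟨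
      x ⊞ cross (y ⊟ x) e · (w ⊟ x)               ≡⟨ cong₂ _,_
        (lemma₁ (proj₁ x) (proj₂ x) (proj₁ y) (proj₂ y) (proj₁ e) (proj₂ e) (proj₁ w) (proj₂ w))
        (lemma₂ (proj₁ x) (proj₂ x) (proj₁ y) (proj₂ y) (proj₁ e) (proj₂ e) (proj₁ w) (proj₂ w)) ⟩
      point (cross (w ⊟ x) e , area x y w)        ∎
      where
      lemma₁ : ∀ x₁ x₂ y₁ y₂ e₁ e₂ w₁ w₂ →
        x₁ + ((y₁ - x₁) * e₂ - e₁ * (y₂ - x₂)) * (w₁ - x₁)
          ≡ (x₁ + ((w₁ - x₁) * e₂ - e₁ * (w₂ - x₂)) * (y₁ - x₁))
            + ((y₁ - x₁) * (w₂ - x₂) - (w₁ - x₁) * (y₂ - x₂)) * e₁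
      lemma₁ = solve 8 (λ x₁ x₂ y₁ y₂ e₁ e₂ w₁ w₂ →
        x₁ :+ ((y₁ :- x₁) :* e₂ :- e₁ :* (y₂ :- x₂)) :* (w₁ :- x₁)
          := (x₁ :+ ((w₁ :- x₁) :* e₂ :- e₁ :* (w₂ :- x₂)) :* (y₁ :- x₁))
             :+ ((y₁ :- x₁) :* (w₂ :- x₂) :- (w₁ :- x₁) :* (y₂ :- x₂)) :* e₁) refl
      lemma₂ : ∀ x₁ x₂ y₁ y₂ e₁ e₂ w₁ w₂ →
        x₂ + ((y₁ - x₁) * e₂ - e₁ * (y₂ - x₂)) * (w₂ - x₂)
          ≡ (x₂ + ((w₁ - x₁) * e₂ - e₁ * (w₂ - x₂)) * (y₂ - x₂))
            + ((y₁ - x₁) * (w₂ - x₂) - (w₁ - x₁) * (y₂ - x₂)) * e₂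
      lemma₂ = solve 8 (λ x₁ x₂ y₁ y₂ e₁ e₂ w₁ w₂ →
        x₂ :+ ((y₁ :- x₁) :* e₂ :- e₁ :* (y₂ :- x₂)) :* (w₂ :- x₂)
          := (x₂ :+ ((w₁ :- x₁) :* e₂ :- e₁ :* (w₂ :- x₂)) :* (y₂ :- x₂))
             :+ ((y₁ :- x₁) :* (w₂ :- x₂) :- (w₁ :- x₁) :* (y₂ :- x₂)) :* e₂) refl

    along≡point : ∀ c → along x y c ≡ point (c , 0#)
    along≡point c = sym (cong₂ _,_ (lemma _ _) (lemma _ _))
      where
      lemma : ∀ a b → a + 0# * b ≡ a
      lemma a b = trans (cong (a +_) (zeroˡ b)) (+-identityʳ a)

    along-injective : ∀ {c c′} → along x y c ≡ along x y c′ → c ≡ c′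
    along-injective {c} {c′} eq = cong proj₁ $ point-injective $
      trans (sym (along≡point c)) (trans eq (along≡point c′))

  open Frame using (along-injective)

  -- Description of the two kinds of orbits by parameter and area

  gal-0 : ∀ φ → fun φ 0# ≡ 0#
  gal-0 φ with _ , _ , _ , φ0≡0 , _ ← laws φ = φ0≡0

  gal-1 : ∀ φ → fun φ 1# ≡ 1#
  gal-1 φ with _ , _ , _ , _ , φ1≡1 , _ ← laws φ = φ1≡1

  gal-≢0 : ∀ φ {a} → a ≢ 0# → fun φ a ≢ 0#
  gal-≢0 φ a≢0 φa≡0 = a≢0 (FromLaws.kernel (fun φ) (laws φ) _ φa≡0)

  gal-≢1 : ∀ φ {a} → a ≢ 1# → fun φ a ≢ 1#
  gal-≢1 φ a≢1 φa≡1 =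
    a≢1 (FromLaws.injective (fun φ) (laws φ) (trans φa≡1 (sym (gal-1 φ))))

  LineOrbit PlaneOrbit : Carrier → V → V → V → Set
  LineOrbit  a x y z = Orbit (0# ⃗ , 1# ⃗ , a ⃗) (x , y , z)
  PlaneOrbit a x y z = Orbit (0# ⃗ , 1# ⃗ , (0# , a)) (x , y , z)

  -- The translation cancels in the differences and the linear part scales area by its determinant
  -- 1, so only the action of the field automorphism remains.
  area-image : ∀ g a → area (g ▸ 0# ⃗) (g ▸ 1# ⃗) (g ▸ (0# , a)) ≡ fun (ASL_H.φ g) a
  area-image (asl (mat b₁₁ b₁₂ b₂₁ b₂₂) det≡1 φ (t₁ , t₂)) a
    rewrite gal-0 φ | gal-1 φ = begin
      _                                         ≡⟨ lemma b₁₁ b₁₂ b₂₁ b₂₂ t₁ t₂ (fun φ a) ⟩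
      (b₁₁ * b₂₂ - b₁₂ * b₂₁) * fun φ a         ≡⟨ cong (_* fun φ a) det≡1 ⟩
      1# * fun φ a                              ≡⟨ *-identityˡ _ ⟩
      fun φ a                                   ∎
    where
    lemma : ∀ b₁₁ b₁₂ b₂₁ b₂₂ t₁ t₂ k →
      area ((b₁₁ * 0# + b₁₂ * 0#) + t₁ , (b₂₁ * 0# + b₂₂ * 0#) + t₂)
           ((b₁₁ * 1# + b₁₂ * 0#) + t₁ , (b₂₁ * 1# + b₂₂ * 0#) + t₂)
           ((b₁₁ * 0# + b₁₂ * k) + t₁ , (b₂₁ * 0# + b₂₂ * k) + t₂)
        ≡ (b₁₁ * b₂₂ - b₁₂ * b₂₁) * k
    lemma = solve 7 (λ b₁₁ b₁₂ b₂₁ b₂₂ t₁ t₂ k →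
      let x₁ = (b₁₁ :* con 0ℤ :+ b₁₂ :* con 0ℤ) :+ t₁
          x₂ = (b₂₁ :* con 0ℤ :+ b₂₂ :* con 0ℤ) :+ t₂
          y₁ = (b₁₁ :* con 1ℤ :+ b₁₂ :* con 0ℤ) :+ t₁
          y₂ = (b₂₁ :* con 1ℤ :+ b₂₂ :* con 0ℤ) :+ t₂
          z₁ = (b₁₁ :* con 0ℤ :+ b₁₂ :* k) :+ t₁
          z₂ = (b₂₁ :* con 0ℤ :+ b₂₂ :* k) :+ t₂
      in (y₁ :- x₁) :* (z₂ :- x₂) :- (z₁ :- x₁) :* (y₂ :- x₂)
           := (b₁₁ :* b₂₂ :- b₁₂ :* b₂₁) :* k) refl

  -- Affine maps preserve parameters on a line; the automorphism changes `a` and fixes the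
  -- parameters `0#` and `1#` of the endpoints.
  along-image : ∀ g a → g ▸ a ⃗ ≡ along (g ▸ 0# ⃗) (g ▸ 1# ⃗) (fun (ASL_H.φ g) a)
  along-image (asl (mat b₁₁ b₁₂ b₂₁ b₂₂) _ φ (t₁ , t₂)) a
    rewrite gal-0 φ | gal-1 φ =
      cong₂ _,_ (lemma b₁₁ b₁₂ t₁ (fun φ a)) (lemma b₂₁ b₂₂ t₂ (fun φ a))
    where
    lemma : ∀ b c t k →
      (b * k + c * 0#) + t
        ≡ ((b * 0# + c * 0#) + t) + k * (((b * 1# + c * 0#) + t) - ((b * 0# + c * 0#) + t))
    lemma = solve 4 (λ b c t k →
      (b :* k :+ c :* con 0ℤ) :+ t
        := ((b :* con 0ℤ :+ c :* con 0ℤ) :+ t)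
           :+ k :* (((b :* con 1ℤ :+ c :* con 0ℤ) :+ t)
                    :- ((b :* con 0ℤ :+ c :* con 0ℤ) :+ t))) refl

  -- The point `(0# , 1#)` is an auxiliary witness: its image spans area 1 with the two given
  -- images, whereas coinciding images would span area 0.
  image-distinct : ∀ g → g ▸ 0# ⃗ ≢ g ▸ 1# ⃗
  image-distinct g@(asl _ _ φ _) eq = 1≢0 $ begin
    1#                                                ≡⟨ gal-1 φ ⟨
    fun φ 1#                                          ≡⟨ area-image g 1# ⟨
    area (g ▸ 0# ⃗) (g ▸ 1# ⃗) (g ▸ (0# , 1#))          ≡⟨ cong (λ y → area (g ▸ 0# ⃗) y (g ▸ (0# , 1#))) eq ⟨
    area (g ▸ 0# ⃗) (g ▸ 0# ⃗) (g ▸ (0# , 1#))          ≡⟨ area-degenerate (g ▸ 0# ⃗) (g ▸ (0# , 1#)) ⟩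
    0#                                                ∎

  line-distinct : ∀ {a x y z} → LineOrbit a x y z → x ≢ y
  line-distinct (g , refl) = image-distinct g

  line-along : ∀ {a x y z} → LineOrbit a x y z → Σ Gal λ τ → z ≡ along x y (fun τ a)
  line-along {a} (g , refl) = ASL_H.φ g , along-image g a

  along-line : ∀ {a x y} τ → x ≢ y → LineOrbit a x y (along x y (fun τ a))
  along-line {a} {x@(x₁ , x₂)} {y@(y₁ , y₂)} τ x≢y = g , images
    where
    open Frame x≢y using (e; cross-e≡1)
    g : ASL_H
    -- The columns are `y ⊟ x` and its complement `e`. The column `e` supplies the determinant 1 and
    -- is multiplied by the second coordinate of `c ⃗`, which is 0.
    g = asl (mat (y₁ - x₁) (proj₁ e) (y₂ - x₂) (proj₂ e)) cross-e≡1 τ x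
    lemma : ∀ x y e k → ((y - x) * k + e * 0#) + x ≡ x + k * (y - x)
    lemma = solve 4 (λ x y e k →
      ((y :- x) :* k :+ e :* con 0ℤ) :+ x := x :+ k :* (y :- x)) refl
    images-along : ∀ c → g ▸ c ⃗ ≡ along x y (fun τ c)
    images-along c rewrite gal-0 τ =
      cong₂ _,_ (lemma x₁ y₁ (proj₁ e) (fun τ c)) (lemma x₂ y₂ (proj₂ e) (fun τ c))
    images : (g ▸ 0# ⃗ , g ▸ 1# ⃗ , g ▸ a ⃗) ≡ (x , y , along x y (fun τ a))
    images = cong₂ _,_
      (trans (images-along 0#) (trans (cong (along x y) (gal-0 τ)) (along-0 x y)))
      (cong₂ _,_
        (trans (images-along 1#) (trans (cong (along x y) (gal-1 τ)) (along-1 x y)))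
        (images-along a))

  plane-area : ∀ {a x y z} → PlaneOrbit a x y z → Σ Gal λ τ → area x y z ≡ fun τ a
  plane-area {a} (g , refl) = ASL_H.φ g , area-image g a

  area-plane : ∀ {a x y z} τ → a ≢ 0# → area x y z ≡ fun τ a → PlaneOrbit a x y z
  area-plane {a} {x@(x₁ , x₂)} {y@(y₁ , y₂)} {z@(z₁ , z₂)} τ a≢0 area≡τa
    with i , τa*i≡1 ← inverse (fun τ a) (gal-≢0 τ a≢0) = g , images
    where
    B : Matrix
    -- The second column is `z ⊟ x` divided by `fun τ a`: then `(0# , a)` goes to `z`, and the
    -- determinant is the area divided by `fun τ a`.
    B = mat (y₁ - x₁) ((z₁ - x₁) * i) (y₂ - x₂) ((z₂ - x₂) * i)
    det-B : det B ≡ 1#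
    det-B = begin
      det B              ≡⟨ solve 7 (λ x₁ x₂ y₁ y₂ z₁ z₂ i →
                              (y₁ :- x₁) :* ((z₂ :- x₂) :* i) :- ((z₁ :- x₁) :* i) :* (y₂ :- x₂)
                                := ((y₁ :- x₁) :* (z₂ :- x₂) :- (z₁ :- x₁) :* (y₂ :- x₂)) :* i)
                              refl x₁ x₂ y₁ y₂ z₁ z₂ i ⟩
      area x y z * i     ≡⟨ cong (_* i) area≡τa ⟩
      fun τ a * i        ≡⟨ τa*i≡1 ⟩
      1#                 ∎
    g : ASL_H
    g = asl B det-B τ x
    at-0 : ∀ b c x → (b * 0# + c * 0#) + x ≡ x
    at-0 = solve 3 (λ b c x → (b :* con 0ℤ :+ c :* con 0ℤ) :+ x := x) refl
    at-1 : ∀ y c x → ((y - x) * 1# + c * 0#) + x ≡ y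
    at-1 = solve 3 (λ y c x → ((y :- x) :* con 1ℤ :+ c :* con 0ℤ) :+ x := y) refl
    at-a : ∀ b x z → (b * 0# + ((z - x) * i) * fun τ a) + x ≡ z
    at-a b x z = begin
      (b * 0# + ((z - x) * i) * fun τ a) + x
        ≡⟨ solve 5 (λ b x z i k →
             (b :* con 0ℤ :+ ((z :- x) :* i) :* k) :+ x := x :+ (k :* i) :* (z :- x))
             refl b x z i (fun τ a) ⟩
      x + (fun τ a * i) * (z - x)
        ≡⟨ cong (λ k → x + k * (z - x)) τa*i≡1 ⟩
      x + 1# * (z - x)
        ≡⟨ solve 2 (λ x z → x :+ con 1ℤ :* (z :- x) := z) refl x z ⟩
      z ∎
    images : (g ▸ 0# ⃗ , g ▸ 1# ⃗ , g ▸ (0# , a)) ≡ (x , y , z)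
    images rewrite gal-0 τ | gal-1 τ = cong₂ _,_
      (cong₂ _,_ (at-0 _ _ x₁) (at-0 _ _ x₂))
      (cong₂ _,_ (cong₂ _,_ (at-1 y₁ _ x₁) (at-1 y₂ _ x₂))
                 (cong₂ _,_ (at-a _ x₁ z₁) (at-a _ x₂ z₂)))

  line-area : ∀ {a x y z} → LineOrbit a x y z → area x y z ≡ 0#
  line-area {x = x} {y} o with τ , refl ← line-along o = area-along x y _

  plane-area≢0 : ∀ {a x y z} → a ≢ 0# → PlaneOrbit a x y z → area x y z ≢ 0#
  plane-area≢0 a≢0 o area≡0 with τ , area≡τa ← plane-area o =
    gal-≢0 τ a≢0 (trans (sym area≡τa) area≡0)

  plane-distinct₁₂ : ∀ {a x y z} → a ≢ 0# → PlaneOrbit a x y z → x ≢ y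
  plane-distinct₁₂ {x = x} {z = z} a≢0 o refl = plane-area≢0 a≢0 o (area-degenerate x z)

  plane-distinct₁₃ : ∀ {a x y z} → a ≢ 0# → PlaneOrbit a x y z → x ≢ z
  plane-distinct₁₃ {x = x} {y} a≢0 o refl =
    plane-area≢0 a≢0 o (trans (area-rotate x x y) (area-degenerate x y))

  plane-distinct₂₃ : ∀ {a x y z} → a ≢ 0# → PlaneOrbit a x y z → y ≢ z
  plane-distinct₂₃ {x = x} {y} a≢0 o refl =
    plane-area≢0 a≢0 o (trans (sym (area-rotate x y y)) (area-degenerate y x))

  -- Area vanishes on line orbits but not on plane orbits, and negation preserves this. The two
  -- triples are allowed to have opposite areas because in the mixed products they are transposes of
  -- each other.
  line-not-plane : ∀ {a b x y z x′ y′ z′} → b ≢ 0# → area x′ y′ z′ ≡ - area x y z →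
                   LineOrbit a x y z → ¬ PlaneOrbit b x′ y′ z′
  line-not-plane b≢0 swap o o′ = plane-area≢0 b≢0 o′ $
    trans swap (trans (cong -_ (line-area o)) -0#≈0#)

  -- Entries of ternary products as numbers of contributing points

  ∈-elements : ∀ x → x ∈ elements
  ∈-elements x = subst (_∈ elements) (from-to x) (∈.∈-map⁺ _ (∈.∈-allFin _))

  elements-unique : Unique elements
  elements-unique = Unique.map⁺ from-injective (Unique.allFin⁺ n)
    where
    open Inverse enumeration
    from-injective : ∀ {i j} → from i ≡ from j → i ≡ j
    from-injective eq = trans (sym (strictlyInverseˡ _)) (trans (cong to eq) (strictlyInverseˡ _))

  length-elements : length elements ≡ n
  length-elements = trans (List.length-map _ (allFin n)) (List.length-tabulate _)

  ∈-points : ∀ w → w ∈ points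
  ∈-points (w₁ , w₂) = ∈.∈-cartesianProduct⁺ (∈-elements w₁) (∈-elements w₂)

  points-unique : Unique points
  points-unique = Unique.cartesianProduct⁺ elements-unique elements-unique

  R₁? : Decidable R₁
  R₁? (x , y , z) = ¬? (x ≟ᵛ y) ×-dec y ≟ᵛ z

  R₂? : Decidable R₂
  R₂? (x , y , z) = ¬? (x ≟ᵛ y) ×-dec x ≟ᵛ z

  R₃? : Decidable R₃
  R₃? (x , y , z) = ¬? (x ≟ᵛ z) ×-dec x ≟ᵛ y

  line? : ∀ a → Decidable (Orbit (0# ⃗ , 1# ⃗ , a ⃗))
  line? a = orbit? (0# ⃗ , 1# ⃗ , a ⃗)

  plane? : ∀ a → Decidable (Orbit (0# ⃗ , 1# ⃗ , (0# , a)))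
  plane? a = orbit? (0# ⃗ , 1# ⃗ , (0# , a))

  module _ {P Q R : Pred V³ 0ℓ} (P? : Decidable P) (Q? : Decidable Q) (R? : Decidable R) where

    product-zero : ∀ x y z →
      (∀ w → ¬ (P (w , y , z) × Q (x , w , z) × R (x , y , w))) →
      ⟨ adjacency P? , adjacency Q? , adjacency R? ⟩ x y z ≡ 0
    product-zero x y z none =
      trans (sum-of-indicators (λ w → P? (w , y , z)) (λ w → Q? (x , w , z)) (λ w → R? (x , y , w)) points)
            (cong length (List.filter-none _ (All.universal none points)))

    -- Outside `D` no point contributes; on `D` the map `f` matches `as` with the contributing
    -- points. The map may depend on the triple but the list does not, so its length is the constant
    -- coefficient. The type `A` is `Carrier` for line orbits and pairs of coordinates for plane
    -- orbits.
    product-count : {D : Pred V³ 0ℓ} (D? : Decidable D) {A : Set} {as : List A} → Unique as →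
      ∀ x y z →
      (∀ w → P (w , y , z) × Q (x , w , z) × R (x , y , w) → D (x , y , z)) →
      (D (x , y , z) → Σ (A → V) λ f →
         (∀ {a a′} → f a ≡ f a′ → a ≡ a′)
       × (∀ {a} → a ∈ as → P (f a , y , z) × Q (x , f a , z) × R (x , y , f a))
       × (∀ w → P (w , y , z) × Q (x , w , z) × R (x , y , w) → ∃ λ a → a ∈ as × w ≡ f a)) →
      ⟨ adjacency P? , adjacency Q? , adjacency R? ⟩ x y z ≡ length as ℕ.* adjacency D? x y z
    product-count D? {as = as} as! x y z only-D count with D? (x , y , z)
    ... | no ¬D = trans (product-zero x y z (λ w → ¬D ∘ only-D w)) (sym (ℕ.*-zeroʳ (length as)))
    ... | yes D with f , f-inj , into , onto ← count D = begin
      _                         ≡⟨ sum-of-indicators P?′ Q?′ R?′ points ⟩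
      length (filter T? points) ≡⟨ injection⇒length as! (Unique.filter⁺ T? points-unique) f f-inj
                                     (λ a∈ → ∈.∈-filter⁺ T? (∈-points _) (into a∈))
                                     (λ w∈ → onto _ (proj₂ (∈.∈-filter⁻ T? {xs = points} w∈))) ⟩
      length as                 ≡⟨ ℕ.*-identityʳ _ ⟨
      length as ℕ.* 1           ∎
      where
      P?′ = λ w → P? (w , y , z)
      Q?′ = λ w → Q? (x , w , z)
      R?′ = λ w → R? (x , y , w)
      T?  = λ w → P?′ w ×-dec Q?′ w ×-dec R?′ w

  -- Inverse parameters and distinctness of points on a line

  -- Total (recip 0 = 0), so that c ↦ along x z (recip c) is injective on all of F.
  recip : Carrier → Carrier
  recip x with x ≟ 0#
  ... | yes _   = 0#
  ... | no x≢0 = proj₁ (inverse x x≢0)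

  recip-0 : recip 0# ≡ 0#
  recip-0 with 0# ≟ 0#
  ... | yes _   = refl
  ... | no 0≢0 = contradiction refl 0≢0

  recip-inverseʳ : ∀ {x} → x ≢ 0# → x * recip x ≡ 1#
  recip-inverseʳ {x} x≢0 with x ≟ 0#
  ... | yes x≡0 = contradiction x≡0 x≢0
  ... | no x≢0′ = proj₂ (inverse x x≢0′)

  recip≢0 : ∀ {x} → x ≢ 0# → recip x ≢ 0#
  recip≢0 {x} x≢0 r≡0 = 1≢0 $ begin
    1#           ≡⟨ recip-inverseʳ x≢0 ⟨
    x * recip x  ≡⟨ cong (x *_) r≡0 ⟩
    x * 0#       ≡⟨ zeroʳ x ⟩
    0#           ∎

  -- Holding at `0#` too, this makes `recip` injective on the whole field, as `product-count` asks
  -- of its parametrisation.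
  recip-involutive : ∀ x → recip (recip x) ≡ x
  recip-involutive x = [ at-0 , at-≢0 ]′ (toSum (x ≟ 0#))
    where
    at-0 : x ≡ 0# → recip (recip x) ≡ x
    at-0 refl = trans (cong recip recip-0) recip-0
    at-≢0 : x ≢ 0# → recip (recip x) ≡ x
    at-≢0 x≢0 = begin
      recip (recip x)                    ≡⟨ *-identityˡ _ ⟨
      1# * recip (recip x)               ≡⟨ cong (_* recip (recip x)) (recip-inverseʳ x≢0) ⟨
      (x * recip x) * recip (recip x)    ≡⟨ *-assoc x _ _ ⟩
      x * (recip x * recip (recip x))    ≡⟨ cong (x *_) (recip-inverseʳ (recip≢0 x≢0)) ⟩
      x * 1#                             ≡⟨ *-identityʳ x ⟩
      x                                  ∎

  recip-injective : ∀ {x y} → recip x ≡ recip y → x ≡ y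
  recip-injective {x} {y} eq =
    trans (sym (recip-involutive x)) (trans (cong recip eq) (recip-involutive y))

  along-source : ∀ {x y w k} → x ≢ y → y ≡ along x w k → x ≢ w
  along-source {x} {k = k} x≢y y≡ refl = x≢y (sym (trans y≡ (along-self x k)))

  along≢source : ∀ {x y c} → x ≢ y → c ≢ 0# → x ≢ along x y c
  along≢source {x} {y} x≢y c≢0 x≡ = c≢0 (along-injective x≢y (trans (sym x≡) (sym (along-0 x y))))

  along≢target : ∀ {x y c} → x ≢ y → c ≢ 1# → along x y c ≢ y
  along≢target {x} {y} x≢y c≢1 ≡y = c≢1 (along-injective x≢y (trans ≡y (sym (along-1 x y))))

  selected : {P : Pred Carrier 0ℓ} → Decidable P → List Carrier
  selected P? = filter P? elements

  ∈-selected : {P : Pred Carrier 0ℓ} (P? : Decidable P) {c : Carrier} → P c → c ∈ selected P?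
  ∈-selected P? = ∈.∈-filter⁺ P? (∈-elements _)

  selected-unique : {P : Pred Carrier 0ℓ} (P? : Decidable P) → Unique (selected P?)
  selected-unique P? = Unique.filter⁺ P? elements-unique

  selected-satisfies : {P : Pred Carrier 0ℓ} (P? : Decidable P) {c : Carrier} → c ∈ selected P? → P c
  selected-satisfies P? c∈ = proj₂ (∈.∈-filter⁻ P? {xs = elements} c∈)

  -- Products of two line hypermatrices

  -- Here `z` equals `y`. The point `w` has parameter ψ(b) from `x` to `y`, and `y` has parameter
  -- τ(a) from `x` to `w`; by `along-along` the product of the two is 1.
  ⟨I₁,Aᵃ,Aᵇ⟩ : ∀ a b → b ≢ 1# → ⟨ I₁ , A^ a , A^ b ⟩ ≐ p¹ a b • I₁
  ⟨I₁,Aᵃ,Aᵇ⟩ a b b≢1 x y z = product-count R₁? (line? a) (line? b) R₁? (selected-unique S?) x y z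
    (λ { _ ((_ , y≡z) , _ , o) → line-distinct o , y≡z })
    (λ { (x≢y , refl) → along x y , along-injective x≢y , into x≢y ∘ selected-satisfies S? , onto x≢y })
    where
    S? = imagesRelated? (λ s t → s * t ≟ 1#) a b
    into : ∀ {c} → x ≢ y → ImagesRelated (λ s t → s * t ≡ 1#) a b c →
           R₁ (along x y c , y , y) × LineOrbit a x (along x y c) y × LineOrbit b x y (along x y c)
    into x≢y (ψ , refl , τ , τaψb≡1) =
        (along≢target x≢y (gal-≢1 ψ b≢1) , refl)
      , subst (LineOrbit a x w) (sym y≡) (along-line τ (along-source x≢y y≡))
      , along-line ψ x≢y
      where
      w = along x y (fun ψ b)
      y≡ : y ≡ along x w (fun τ a)
      y≡ = begin
        y                                 ≡⟨ along-1 x y ⟨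
        along x y 1#                      ≡⟨ cong (along x y) τaψb≡1 ⟨
        along x y (fun τ a * fun ψ b)     ≡⟨ along-along x y _ _ ⟨
        along x w (fun τ a)               ∎
    onto : x ≢ y → ∀ w → R₁ (w , y , y) × LineOrbit a x w y × LineOrbit b x y w →
           ∃ λ c → c ∈ selected S? × w ≡ along x y c
    onto x≢y w (_ , oa , ob) with ψ , refl ← line-along ob | τ , y≡ ← line-along oa =
      fun ψ b , ∈-selected S? (ψ , refl , τ , along-injective x≢y (begin
        along x y (fun τ a * fun ψ b)     ≡⟨ along-along x y _ _ ⟨
        along x w (fun τ a)               ≡⟨ y≡ ⟨
        y                                 ≡⟨ along-1 x y ⟨
        along x y 1#                      ∎)) , refl

  -- Here `z` equals `x`. The point `w` has parameter ψ(b) from `x` to `y`, and `x` has parameter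
  -- τ(a) from `w` to `y`; the combined parameter in `along-from-along` must be that of `x`, namely
  -- 0.
  ⟨Aᵃ,I₂,Aᵇ⟩ : ∀ a b → b ≢ 0# → b ≢ 1# → ⟨ A^ a , I₂ , A^ b ⟩ ≐ p² a b • I₂
  ⟨Aᵃ,I₂,Aᵇ⟩ a b b≢0 b≢1 x y z = product-count (line? a) R₂? (line? b) R₂? (selected-unique S?) x y z
    (λ { _ (_ , (_ , x≡z) , o) → line-distinct o , x≡z })
    (λ { (x≢y , refl) → along x y , along-injective x≢y , into x≢y ∘ selected-satisfies S? , onto x≢y })
    where
    S? = imagesRelated? (λ s t → s * t ≟ s + t) a b
    into : ∀ {c} → x ≢ y → ImagesRelated (λ s t → s * t ≡ s + t) a b c →
           LineOrbit a (along x y c) y x × R₂ (x , along x y c , x) × LineOrbit b x y (along x y c)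
    into x≢y (ψ , refl , τ , rel) =
        subst (LineOrbit a w y) (sym x≡) (along-line τ (along≢target x≢y (gal-≢1 ψ b≢1)))
      , (along≢source x≢y (gal-≢0 ψ b≢0) , refl)
      , along-line ψ x≢y
      where
      w = along x y (fun ψ b)
      x≡ : x ≡ along w y (fun τ a)
      x≡ = begin
        x                                                            ≡⟨ along-0 x y ⟨
        along x y 0#                                                 ≡⟨ cong (along x y) (x≡y⇒x-y≡0 (sym rel)) ⟨
        along x y ((fun τ a + fun ψ b) - fun τ a * fun ψ b)          ≡⟨ along-from-along x y _ _ ⟨
        along w y (fun τ a)                                          ∎
    onto : x ≢ y → ∀ w → LineOrbit a w y x × R₂ (x , w , x) × LineOrbit b x y w →
           ∃ λ c → c ∈ selected S? × w ≡ along x y c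
    onto x≢y w (oa , _ , ob) with ψ , refl ← line-along ob | τ , x≡ ← line-along oa =
      fun ψ b , ∈-selected S? (ψ , refl , τ , sym (x-y≡0⇒x≡y _ _ (along-injective x≢y (begin
        along x y ((fun τ a + fun ψ b) - fun τ a * fun ψ b)          ≡⟨ along-from-along x y _ _ ⟨
        along w y (fun τ a)                                          ≡⟨ x≡ ⟨
        x                                                            ≡⟨ along-0 x y ⟨
        along x y 0#                                                 ∎)))) , refl

  -- Here `y` equals `x`, and `z` has parameter ψ(b) from `x` to `w`, so `w` has the inverse
  -- parameter from `x` to `z`; hence `recip`. Also `z` has parameter τ(a) from `w` to `x`, and
  -- reversing that line gives ψ(b) = 1 - τ(a).
  ⟨Aᵃ,Aᵇ,I₃⟩ : ∀ a b → b ≢ 0# → ⟨ A^ a , A^ b , I₃ ⟩ ≐ p³ a b • I₃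
  ⟨Aᵃ,Aᵇ,I₃⟩ a b b≢0 x y z = product-count (line? a) (line? b) R₃? R₃? (selected-unique S?) x y z
    (λ { w (_ , o , (_ , x≡y)) → x≢z w o , x≡y })
    (λ { (x≢z , refl) → along x z ∘ recip , recip-injective ∘ along-injective x≢z
                      , into x≢z ∘ selected-satisfies S? , onto })
    where
    S? = imagesRelated? (λ s t → s + t ≟ 1#) a b
    x≢z : ∀ w → LineOrbit b x w z → x ≢ z
    x≢z w o x≡z with ψ , z≡ ← line-along o =
      along≢source (line-distinct o) (gal-≢0 ψ b≢0) (trans x≡z z≡)
    complement : ∀ {s t} → s + t ≡ 1# → 1# - s ≡ t
    complement {s} {t} s+t≡1 = trans (cong (_- s) (sym s+t≡1))
      (solve 2 (λ s t → (s :+ t) :- s := t) refl s t)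
    into : ∀ {c} → x ≢ z → ImagesRelated (λ s t → s + t ≡ 1#) a b c →
           LineOrbit a (along x z (recip c)) x z × LineOrbit b x (along x z (recip c)) z
             × R₃ (x , x , along x z (recip c))
    into {c} x≢z (ψ , refl , τ , rel) =
        subst (LineOrbit a w x) (trans (along-reverse x w _) (trans (cong (along x w) (complement rel)) (sym z≡)))
          (along-line τ (x≢w ∘ sym))
      , subst (LineOrbit b x w) (sym z≡) (along-line ψ x≢w)
      , x≢w , refl
      where
      w = along x z (recip c)
      z≡ : z ≡ along x w c
      z≡ = begin
        z                          ≡⟨ along-1 x z ⟨
        along x z 1#               ≡⟨ cong (along x z) (recip-inverseʳ (gal-≢0 ψ b≢0)) ⟨
        along x z (c * recip c)    ≡⟨ along-along x z _ _ ⟨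
        along x w c                ∎
      x≢w : x ≢ w
      x≢w = along-source x≢z z≡
    onto : ∀ w → LineOrbit a w x z × LineOrbit b x w z × R₃ (x , x , w) →
           ∃ λ c → c ∈ selected S? × w ≡ along x z (recip c)
    onto w (oa , ob , x≢w , _) with ψ , refl ← line-along ob | τ , z≡ ← line-along oa =
      c , ∈-selected S? (ψ , refl , τ , rel) , sym (begin
        along x (along x w c) (recip c)  ≡⟨ along-along x w _ _ ⟩
        along x w (recip c * c)          ≡⟨ cong (along x w) (trans (*-comm _ c) (recip-inverseʳ (gal-≢0 ψ b≢0))) ⟩
        along x w 1#                     ≡⟨ along-1 x w ⟩
        w                                ∎)
      where
      c = fun ψ b
      rel : fun τ a + c ≡ 1#
      rel = begin
        fun τ a + c                 ≡⟨ cong (λ k → fun τ a + k) (along-injective x≢w (trans z≡ (along-reverse x w _))) ⟩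
        fun τ a + (1# - fun τ a)    ≡⟨ solve 1 (λ k → k :+ (con 1ℤ :- k) := con 1ℤ) refl (fun τ a) ⟩
        1#                          ∎

  -- Vanishing of the mixed products

  -- In each of the six products the equality forced by the trivial factor makes the triples of the
  -- other two factors differ by a transposition: of positions 2 and 3 for `I₁`, 1 and 3 for `I₂`, 1
  -- and 2 for `I₃`.
  ⟨I₁,Aᵃ,ᵇA⟩ : ∀ a b → b ≢ 0# → ⟨ I₁ , A^ a , ^A b ⟩ ≐ 𝟘
  ⟨I₁,Aᵃ,ᵇA⟩ a b b≢0 x y z = product-zero R₁? (line? a) (plane? b) x y z
    λ { w ((_ , refl) , o , o′) → line-not-plane b≢0 (area-swap₂₃ x w y) o o′ }

  ⟨I₁,ᵇA,Aᵃ⟩ : ∀ a b → b ≢ 0# → ⟨ I₁ , ^A b , A^ a ⟩ ≐ 𝟘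
  ⟨I₁,ᵇA,Aᵃ⟩ a b b≢0 x y z = product-zero R₁? (plane? b) (line? a) x y z
    λ { w ((_ , refl) , o′ , o) → line-not-plane b≢0 (area-swap₂₃ x y w) o o′ }

  ⟨Aᵃ,I₂,ᵇA⟩ : ∀ a b → b ≢ 0# → ⟨ A^ a , I₂ , ^A b ⟩ ≐ 𝟘
  ⟨Aᵃ,I₂,ᵇA⟩ a b b≢0 x y z = product-zero (line? a) R₂? (plane? b) x y z
    λ { w (o , (_ , refl) , o′) → line-not-plane b≢0 (area-swap₁₃ w y x) o o′ }

  ⟨ᵇA,I₂,Aᵃ⟩ : ∀ a b → b ≢ 0# → ⟨ ^A b , I₂ , A^ a ⟩ ≐ 𝟘
  ⟨ᵇA,I₂,Aᵃ⟩ a b b≢0 x y z = product-zero (plane? b) R₂? (line? a) x y z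
    λ { w (o′ , (_ , refl) , o) → line-not-plane b≢0 (area-swap₁₃ x y w) o o′ }

  ⟨Aᵃ,ᵇA,I₃⟩ : ∀ a b → b ≢ 0# → ⟨ A^ a , ^A b , I₃ ⟩ ≐ 𝟘
  ⟨Aᵃ,ᵇA,I₃⟩ a b b≢0 x y z = product-zero (line? a) (plane? b) R₃? x y z
    λ { w (o , o′ , (_ , refl)) → line-not-plane b≢0 (area-swap₁₂ w x z) o o′ }

  ⟨ᵇA,Aᵃ,I₃⟩ : ∀ a b → b ≢ 0# → ⟨ ^A b , A^ a , I₃ ⟩ ≐ 𝟘
  ⟨ᵇA,Aᵃ,I₃⟩ a b b≢0 x y z = product-zero (plane? b) (line? a) R₃? x y z
    λ { w (o′ , o , (_ , refl)) → line-not-plane b≢0 (area-swap₁₂ x w z) o o′ }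

  -- Products of two plane hypermatrices

  -- The triples of the two plane factors are transposes, so their areas τ(a) and ψ(b) are opposite.
  -- This direction produces contributing points from an area; `opposite-areas` is the converse.
  opposite-planes : ∀ {a b c x y z x′ y′ z′} → a ≢ 0# → b ≢ 0# →
    area x′ y′ z′ ≡ - area x y z → area x y z ≡ c → ImagesRelated (λ s t → s ≡ - t) a b c →
    PlaneOrbit a x′ y′ z′ × PlaneOrbit b x y z
  opposite-planes a≢0 b≢0 opposite area≡ψb (ψ , refl , τ , τa≡-ψb) =
      area-plane τ a≢0 (trans opposite (trans (cong -_ area≡ψb) (sym τa≡-ψb)))
    , area-plane ψ b≢0 area≡ψb

  opposite-areas : ∀ {a b x y z x′ y′ z′} → area x′ y′ z′ ≡ - area x y z →
    PlaneOrbit a x′ y′ z′ → PlaneOrbit b x y z → ImagesRelated (λ s t → s ≡ - t) a b (area x y z)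
  opposite-areas opposite oa ob with τ , area≡τa ← plane-area oa | ψ , area≡ψb ← plane-area ob =
    ψ , sym area≡ψb , τ , trans (sym area≡τa) (trans opposite (cong -_ area≡ψb))

  module _ (a b : Carrier) (a≢0 : a ≢ 0#) (b≢0 : b ≢ 0#) where

    private
      S? = imagesRelated? (λ s t → s ≟ - t) a b

      -- Coordinates in a `Frame`: the first is free, which gives the factor `n` of `p*`, and the
      -- second is the prescribed area.
      coordinates : List (Carrier × Carrier)
      coordinates = cartesianProduct elements (selected S?)

      coordinates-unique : Unique coordinates
      coordinates-unique = Unique.cartesianProduct⁺ elements-unique (selected-unique S?)

      length-coordinates : length coordinates ≡ p* a b
      length-coordinates = trans (length-cartesianProduct elements (selected S?))
                                 (cong (ℕ._* length (selected S?)) length-elements)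

      ∈-coordinates⁺ : ∀ {s c} → ImagesRelated (λ s t → s ≡ - t) a b c → (s , c) ∈ coordinates
      ∈-coordinates⁺ {s} rel = ∈.∈-cartesianProduct⁺ (∈-elements s) (∈-selected S? rel)

      ∈-coordinates⁻ : ∀ {s c} → (s , c) ∈ coordinates → ImagesRelated (λ s t → s ≡ - t) a b c
      ∈-coordinates⁻ sc∈ =
        selected-satisfies S? (proj₂ (∈.∈-cartesianProduct⁻ elements (selected S?) sc∈))

      as-p* : ∀ {m k} → m ≡ length coordinates ℕ.* k → m ≡ p* a b ℕ.* k
      as-p* {k = k} eq = trans eq (cong (ℕ._* k) length-coordinates)

    -- With `z` equal to `y`, membership in both orbits depends only on the area of `w` relative to
    -- `x` and `y`. The inequality required by `I₁` follows because that area is nonzero.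
    ⟨I₁,ᵃA,ᵇA⟩ : ⟨ I₁ , ^A a , ^A b ⟩ ≐ p* a b • I₁
    ⟨I₁,ᵃA,ᵇA⟩ x y z = as-p* $
      product-count R₁? (plane? a) (plane? b) R₁? coordinates-unique x y z
        (λ { _ ((_ , y≡z) , _ , o) → plane-distinct₁₂ b≢0 o , y≡z })
        (λ { (x≢y , refl) → let open Frame x≢y in point , point-injective
           , (λ {(s , c)} sc∈ →
                let oa , ob = opposite-planes a≢0 b≢0 (area-swap₂₃ x y (point (s , c)))
                                (area-point s c) (∈-coordinates⁻ sc∈)
                in (plane-distinct₂₃ a≢0 oa , refl) , oa , ob)
           , (λ w (_ , oa , ob) →
                _ , ∈-coordinates⁺ (opposite-areas (area-swap₂₃ x y w) oa ob) , point-surjective w) })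

    ⟨ᵃA,I₂,ᵇA⟩ : ⟨ ^A a , I₂ , ^A b ⟩ ≐ p* a b • I₂
    ⟨ᵃA,I₂,ᵇA⟩ x y z = as-p* $
      product-count (plane? a) R₂? (plane? b) R₂? coordinates-unique x y z
        (λ { _ (_ , (_ , x≡z) , o) → plane-distinct₁₂ b≢0 o , x≡z })
        (λ { (x≢y , refl) → let open Frame x≢y in point , point-injective
           , (λ {(s , c)} sc∈ →
                let oa , ob = opposite-planes a≢0 b≢0 (area-swap₁₃ x y (point (s , c)))
                                (area-point s c) (∈-coordinates⁻ sc∈)
                in oa , (plane-distinct₁₃ b≢0 ob , refl) , ob)
           , (λ w (oa , _ , ob) →
                _ , ∈-coordinates⁺ (opposite-areas (area-swap₁₃ x y w) oa ob) , point-surjective w) })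

    ⟨ᵃA,ᵇA,I₃⟩ : ⟨ ^A a , ^A b , I₃ ⟩ ≐ p* a b • I₃
    ⟨ᵃA,ᵇA,I₃⟩ x y z = as-p* $
      product-count (plane? a) (plane? b) R₃? R₃? coordinates-unique x y z
        (λ { _ (_ , o , (_ , x≡y)) → plane-distinct₁₃ b≢0 o , x≡y })
        -- The frame is based at `z` and directed to `x`: the triple `(x , w , z)` has the same area
        -- as its rotation `(z , x , w)`, in which `w` comes last.
        (λ { (x≢z , refl) → let open Frame (x≢z ∘ sym) in point , point-injective
           , (λ {(s , c)} sc∈ →
                let oa , ob = opposite-planes a≢0 b≢0 (area-swap₁₂ x (point (s , c)) z)
                                (trans (area-rotate z x (point (s , c))) (area-point s c))
                                (∈-coordinates⁻ sc∈)
                in oa , ob , plane-distinct₁₂ b≢0 ob , refl)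
           , (λ w (oa , ob , _) →
                _ , ∈-coordinates⁺ (subst (ImagesRelated (λ s t → s ≡ - t) a b) (area-rotate z x w)
                                     (opposite-areas (area-swap₁₂ x w z) oa ob))
                  , point-surjective w) })

theorem3p4 : (p α ω : ℕ) → Prime p → ω ∣ α →
    (F : FiniteField (p ^ α)) (K : FiniteField (p ^ ω)) (ι : FieldEmbedding K F) →
    let open FiniteField F
        open ASL ι
    in
      ((a b : Carrier) → a ≢ 0# → a ≢ 1# → b ≢ 0# → b ≢ 1# →
          (⟨ I₁ , A^ a , A^ b ⟩ ≐ p¹ a b • I₁)
        × (⟨ A^ a , I₂ , A^ b ⟩ ≐ p² a b • I₂)
        × (⟨ A^ a , A^ b , I₃ ⟩ ≐ p³ a b • I₃))
    × ((a 𝔞 : Carrier) → a ≢ 0# → a ≢ 1# → 𝔞 ≢ 0# →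
          (⟨ I₁ , A^ a , ^A 𝔞 ⟩ ≐ 𝟘) × (⟨ I₁ , ^A 𝔞 , A^ a ⟩ ≐ 𝟘)
        × (⟨ A^ a , I₂ , ^A 𝔞 ⟩ ≐ 𝟘) × (⟨ ^A 𝔞 , I₂ , A^ a ⟩ ≐ 𝟘)
        × (⟨ A^ a , ^A 𝔞 , I₃ ⟩ ≐ 𝟘) × (⟨ ^A 𝔞 , A^ a , I₃ ⟩ ≐ 𝟘))
    × ((𝔞 𝔟 : Carrier) → 𝔞 ≢ 0# → 𝔟 ≢ 0# →
          (⟨ I₁ , ^A 𝔞 , ^A 𝔟 ⟩ ≐ p* 𝔞 𝔟 • I₁)
        × (⟨ ^A 𝔞 , I₂ , ^A 𝔟 ⟩ ≐ p* 𝔞 𝔟 • I₂)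
        × (⟨ ^A 𝔞 , ^A 𝔟 , I₃ ⟩ ≐ p* 𝔞 𝔟 • I₃))
theorem3p4 p α ω _ _ F K ι =
    (λ a b _ _ b≢0 b≢1 → ⟨I₁,Aᵃ,Aᵇ⟩ a b b≢1 , ⟨Aᵃ,I₂,Aᵇ⟩ a b b≢0 b≢1 , ⟨Aᵃ,Aᵇ,I₃⟩ a b b≢0)
  , (λ a 𝔞 _ _ 𝔞≢0 → ⟨I₁,Aᵃ,ᵇA⟩ a 𝔞 𝔞≢0 , ⟨I₁,ᵇA,Aᵃ⟩ a 𝔞 𝔞≢0
                   , ⟨Aᵃ,I₂,ᵇA⟩ a 𝔞 𝔞≢0 , ⟨ᵇA,I₂,Aᵃ⟩ a 𝔞 𝔞≢0
                   , ⟨Aᵃ,ᵇA,I₃⟩ a 𝔞 𝔞≢0 , ⟨ᵇA,Aᵃ,I₃⟩ a 𝔞 𝔞≢0)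
  , (λ 𝔞 𝔟 𝔞≢0 𝔟≢0 → ⟨I₁,ᵃA,ᵇA⟩ 𝔞 𝔟 𝔞≢0 𝔟≢0 , ⟨ᵃA,I₂,ᵇA⟩ 𝔞 𝔟 𝔞≢0 𝔟≢0
                   , ⟨ᵃA,ᵇA,I₃⟩ 𝔞 𝔟 𝔞≢0 𝔟≢0)
  where open Geometry ι
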